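{- Let $X$ be a normal modal logic and let $I$ be an index set with $\omega\subseteq I$. Suppose that $X$ is complete with respect to a set of Kripke frames $F=\{(G_\alpha,R_\alpha):\alpha\in I\}$, where for every $\alpha\in I$, $G_\alpha$ is a nonempty infinite set and $R_\alpha$ is an accessibility relation (a binary relation) on $G_\alpha$. Let $H=\{(G_i^*,R_i^*): i\in\omega\}$ be a set of Kripke frames such that for every $i\in\omega$: $$G_i^*=\{*,g_0,g_1,\dots,g_i\}\cup G_{\omega i},$$ where $G_{\omega i}=\{\eta_{ij}: j\in\omega\}$ has cardinality $\aleph_0$, $\{*,g_0,\dots,g_i\}\cap G_{\omega i}=\emptyset$, the elements $*,g_0,\dots,g_i$ are distinct, and $$R_i^*=\{(*,g_j):0\le j\le i\}\cup\{(g_j,g_j): 1\le j\le i\}\cup\{(\eta,\eta):\eta\in G_{\omega i}\}.$$ If $H\subseteq F$, then $B$-translation is faithful with respect to $X$.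
   Context: The system $\mathbf{L_1}$ (Leśniewski's propositional ontology): fix a countably infinite set of name variables. The atomic formulas are exactly the expressions $\epsilon ab$ with $a,b$ name variables (possibly equal); formulas are built from atomic formulas by $\vee$ and $\neg$, the other connectives being the usual classical abbreviations. $\mathbf{L_1}$ is a Hilbert-style system of classical propositional logic (with modus ponens) over these formulas with the additional axiom schemata, for all name variables $a,b,c$: (Ax1) $\epsilon ab \supset \epsilon aa$; (Ax2) $(\epsilon ab \wedge \epsilon bc) \supset \epsilon ac$; (Ax3) $(\epsilon ab \wedge \epsilon bc) \supset \epsilon ba$. $B$-translation: to each name variable $a$ corresponds a propositional variable $p_a$, with distinct name variables corresponding to distinct propositional variables. $B$ maps formulas of $\mathbf{L_1}$ to propositional modal formulas by $B(\phi\vee\psi)=B(\phi)\vee B(\psi)$, $B(\neg\phi)=\neg B(\phi)$, $B(\epsilon ab)=p_a\wedge\Box(p_a\supset p_b)\wedge\bigl(p_b\supset\Box(p_b\supset p_a)\bigr)$. $B$-translation is faithful with respect to a modal logic $X$ if for every formula $\phi$ of $\mathbf{L_1}$, $\vdash_X B(\phi)$ implies $\vdash_{\mathbf{L_1}}\phi$. A normal modal logic is a set $X$ of propositional modal formulas with $\mathbf{K}\subseteq X$ that is closed under modus ponens, substitution and necessitation. $X$ is complete with respect to a set $F$ of Kripke frames if, for every modal formula $\chi$, $\vdash_X\chi$ holds if and only if $\chi$ is valid in every frame in $F$. -}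

module Defs where

open import Level using (Level; suc; _⊔_)
open import Data.Nat using (ℕ)
open import Data.Fin using (Fin; zero)
open import Data.Product using (_×_; ∃)
open import Data.Sum using (_⊎_)
open import Function.Bundles using (_⇔_; _↔_)
open import Function.Definitions using (Injective)
open import Relation.Binary.Core using (Rel)
open import Relation.Binary.PropositionalEquality using (_≡_; _≢_)
open import Relation.Nullary using (¬_)
open import Relation.Unary using (Pred; _∈_)

private
  variable
    i j ℓ x : Level

-- Classical propositional logic over any language with primitive
-- disjunction and negation.  The schemata below, closed under modus ponens,
-- derive every classical tautology: the first three are the usual
-- implication–negation basis (for ⊃ read as an abbreviation), the last
-- three are the introduction and elimination laws of ∨.

module Classical {F : Set} (_∨_ : F → F → F) (∼_ : F → F) where

  infixr 6 _∧_
  infixr 4 _⊃_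

  _⊃_ : F → F → F
  φ ⊃ ψ = (∼ φ) ∨ ψ

  _∧_ : F → F → F
  φ ∧ ψ = ∼ ((∼ φ) ∨ (∼ ψ))

  data Axiom : F → Set where
    weaken    : ∀ φ ψ → Axiom (φ ⊃ (ψ ⊃ φ))
    distrib   : ∀ φ ψ χ → Axiom ((φ ⊃ (ψ ⊃ χ)) ⊃ ((φ ⊃ ψ) ⊃ (φ ⊃ χ)))
    contrapos : ∀ φ ψ → Axiom (((∼ φ) ⊃ (∼ ψ)) ⊃ (ψ ⊃ φ))
    ∨-introˡ  : ∀ φ ψ → Axiom (φ ⊃ (φ ∨ ψ))
    ∨-introʳ  : ∀ φ ψ → Axiom (ψ ⊃ (φ ∨ ψ))
    ∨-elim    : ∀ φ ψ χ → Axiom ((φ ⊃ χ) ⊃ ((ψ ⊃ χ) ⊃ ((φ ∨ ψ) ⊃ χ)))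

NameVar : Set
NameVar = ℕ

module L₁ where

  infixr 5 _∨_
  infix  8 ∼_

  data Formula : Set where
    ε   : NameVar → NameVar → Formula
    _∨_ : Formula → Formula → Formula
    ∼_  : Formula → Formula

  open Classical _∨_ ∼_ public

  infix 2 ⊢_

  data ⊢_ : Formula → Set where
    classical : ∀ {φ} → Axiom φ → ⊢ φ
    ax1       : ∀ a b → ⊢ ε a b ⊃ ε a a
    ax2       : ∀ a b c → ⊢ (ε a b ∧ ε b c) ⊃ ε a c
    ax3       : ∀ a b c → ⊢ (ε a b ∧ ε b c) ⊃ ε b a
    mp        : ∀ {φ ψ} → ⊢ φ ⊃ ψ → ⊢ φ → ⊢ ψ

PropVar : Set
PropVar = ℕ

module Modal where

  infixr 5 _∨_
  infix  8 ∼_ □_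

  data Formula : Set where
    var : PropVar → Formula
    _∨_ : Formula → Formula → Formula
    ∼_  : Formula → Formula
    □_  : Formula → Formula

  open Classical _∨_ ∼_ public

  subst : (PropVar → Formula) → Formula → Formula
  subst σ (var p) = σ p
  subst σ (φ ∨ ψ) = subst σ φ ∨ subst σ ψ
  subst σ (∼ φ)   = ∼ subst σ φ
  subst σ (□ φ)   = □ subst σ φ

  data 𝐊 : Pred Formula Level.zero where
    classical : ∀ {φ} → Axiom φ → 𝐊 φ
    axK       : ∀ φ ψ → 𝐊 (□ (φ ⊃ ψ) ⊃ (□ φ ⊃ □ ψ))
    mp        : ∀ {φ ψ} → 𝐊 (φ ⊃ ψ) → 𝐊 φ → 𝐊 ψ
    nec       : ∀ {φ} → 𝐊 φ → 𝐊 (□ φ)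

  record IsNormal (X : Pred Formula x) : Set x where
    field
      K⊆X          : ∀ {φ} → φ ∈ 𝐊 → φ ∈ X
      modusPonens  : ∀ {φ ψ} → (φ ⊃ ψ) ∈ X → φ ∈ X → ψ ∈ X
      substitution : ∀ σ {φ} → φ ∈ X → subst σ φ ∈ X
      necessitation : ∀ {φ} → φ ∈ X → (□ φ) ∈ X

record Frame (ℓ : Level) : Set (suc ℓ) where
  constructor frame
  field
    World : Set ℓ
    Acc   : Rel World ℓ

module _ (𝓕 : Frame ℓ) where
  open Frame 𝓕
  open Modal

  Valuation : Set (suc ℓ)
  Valuation = PropVar → Pred World ℓ

  -- Truth values are types, so the clauses are the textbook ones and have
  -- their textbook meaning under excluded middle.  No such principle has to
  -- be assumed separately: a logic containing 𝐊 that is sound for an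
  -- inhabited frame forces P ⊎ ¬ P for every P : Set ℓ (interpret a variable
  -- as constantly P).

  Forces : Valuation → World → Formula → Set ℓ
  Forces V w (var p) = V p w
  Forces V w (φ ∨ ψ) = Forces V w φ ⊎ Forces V w ψ
  Forces V w (∼ φ)   = ¬ Forces V w φ
  Forces V w (□ φ)   = ∀ v → Acc w v → Forces V v φ

  Valid : Formula → Set (suc ℓ)
  Valid φ = ∀ V w → Forces V w φ

-- A set of frames is given as an indexed family.

CompleteFor : {I : Set i} → Pred Modal.Formula x → (I → Frame ℓ) →
              Set (i ⊔ x ⊔ suc ℓ)
CompleteFor X F = ∀ χ → (χ ∈ X) ⇔ (∀ α → Valid (F α) χ)

infix 4 _⊆ᶠ_

_⊆ᶠ_ : {I : Set i} {J : Set j} → (J → Frame ℓ) → (I → Frame ℓ) →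
       Set (i ⊔ j ⊔ suc ℓ)
H ⊆ᶠ F = ∀ β → ∃ λ α → H β ≡ F α

Infinite : Set ℓ → Set ℓ
Infinite A = ∀ n → ¬ (A ↔ Fin n)

-- The worlds are exactly *, g₀, …, gₙ and the ηⱼ (j ∈ ω), pairwise distinct.
-- The point g₀ is a dead end.

record IsStarFrame (n : ℕ) (𝓕 : Frame ℓ) : Set ℓ where
  open Frame 𝓕
  field
    *   : World
    g   : Fin (ℕ.suc n) → World
    η   : ℕ → World

    g-injective : Injective _≡_ _≡_ g
    η-injective : Injective _≡_ _≡_ η
    *≢g         : ∀ j → * ≢ g j
    *≢η         : ∀ k → * ≢ η k
    g≢η         : ∀ j k → g j ≢ η k

    exhaustive  : ∀ w → (w ≡ *) ⊎ (∃ λ j → w ≡ g j) ⊎ (∃ λ k → w ≡ η k)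

    accessible  : ∀ u v → Acc u v ⇔
                    ( (∃ λ j → u ≡ * × v ≡ g j)
                    ⊎ (∃ λ j → j ≢ zero × u ≡ g j × v ≡ g j)
                    ⊎ (∃ λ k → u ≡ η k × v ≡ η k))

module _ (p : NameVar → PropVar) where
  open Modal

  B : L₁.Formula → Formula
  B (L₁.ε a b)  = var (p a) ∧ □ (var (p a) ⊃ var (p b))
                            ∧ (var (p b) ⊃ □ (var (p b) ⊃ var (p a)))
  B (φ L₁.∨ ψ)  = B φ ∨ B ψ
  B (L₁.∼ φ)    = ∼ B φ

  Faithful : Pred Formula x → Set x
  Faithful X = ∀ φ → B φ ∈ X → L₁.⊢ φ

-- Suppose φ is unprovable. Extend the empty context to a finite context Δ that
-- still does not prove φ but decides every subformula of φ, and let a ∈ b mean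
-- that Δ proves ε a b. This relation obeys the three axioms. Take a star frame
-- with a point gⱼ for each name j ≤ n, where n bounds the left-hand names in φ,
-- and make p_a true at * when a ∈ a and at gⱼ when j ∈ a. Then B (ε a b) holds
-- at * iff a ∈ b: the inclusion of a in b is tested at the point g_a itself.
-- Hence B φ fails at *. Excluded middle comes from the soundness of X on an
-- inhabited frame.
module Submission where

open import Defs
open import Level using (Level; Lift; lift; lower)
open import Axiom.ExcludedMiddle using (ExcludedMiddle)
open import Data.Fin using (Fin; toℕ; fromℕ<)
open import Data.Fin.Properties using (toℕ-fromℕ<)
open import Data.List using (List; []; _∷_; _++_)
open import Data.List.Membership.Propositional using (_∈_)
open import Data.List.Relation.Unary.All as All using (All; []; _∷_)
open import Data.List.Relation.Unary.All.Properties using (++⁻ˡ; ++⁻ʳ)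
open import Data.List.Relation.Unary.Any using (here; there)
open import Data.Nat using (ℕ; _≤_; s≤s; _⊔_)
open import Data.Nat.Properties using (≤-refl; m⊔n≤o⇒m≤o; m⊔n≤o⇒n≤o)
open import Data.Product using (_×_; ∃; _,_; proj₁)
open import Data.Sum as Sum using (_⊎_; inj₁; inj₂; [_,_]′)
open import Function.Base using (_∘_)
open import Function.Bundles using (_↣_; _⇔_; mk⇔; module Equivalence)
open import Function.Definitions using (Injective)
open import Relation.Binary.Core using (Rel)
open import Relation.Binary.PropositionalEquality using (_≡_; refl; sym; subst)
open import Relation.Nullary using (¬_; yes; no; contradiction)
open import Relation.Nullary.Decidable using (map′; fromSum; toSum; decidable-stable)
open import Relation.Unary using (Pred)

open Equivalence using (to; from)

private
  variable
    ℓ : Level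

-- Derivations from finite contexts.

module Contexts where
  open L₁

  infix 2 _⊩_

  data _⊩_ (Γ : List Formula) : Formula → Set where
    hyp : ∀ {φ} → φ ∈ Γ → Γ ⊩ φ
    thm : ∀ {φ} → ⊢ φ → Γ ⊩ φ
    mp  : ∀ {φ ψ} → Γ ⊩ φ ⊃ ψ → Γ ⊩ φ → Γ ⊩ ψ

  ⊩-axiom : ∀ {Γ φ} → Axiom φ → Γ ⊩ φ
  ⊩-axiom = thm ∘ classical

  []⊩⇒⊢ : ∀ {φ} → [] ⊩ φ → ⊢ φ
  []⊩⇒⊢ (thm d)  = d
  []⊩⇒⊢ (mp d e) = mp ([]⊩⇒⊢ d) ([]⊩⇒⊢ e)

  ⊩-weaken : ∀ {Γ α φ} → Γ ⊩ φ → α ∷ Γ ⊩ φ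
  ⊩-weaken (hyp φ∈Γ) = hyp (there φ∈Γ)
  ⊩-weaken (thm d)   = thm d
  ⊩-weaken (mp d e)  = mp (⊩-weaken d) (⊩-weaken e)

  ⊃-const : ∀ {Γ α φ} → Γ ⊩ φ → Γ ⊩ α ⊃ φ
  ⊃-const = mp (⊩-axiom (weaken _ _))

  ⊃-refl : ∀ {Γ} α → Γ ⊩ α ⊃ α
  ⊃-refl α = mp (mp (⊩-axiom (distrib α (α ⊃ α) α)) (⊩-axiom (weaken _ _)))
                (⊩-axiom (weaken _ _))

  deduction : ∀ {Γ α φ} → α ∷ Γ ⊩ φ → Γ ⊩ α ⊃ φ
  deduction (hyp (here refl)) = ⊃-refl _
  deduction (hyp (there φ∈Γ)) = ⊃-const (hyp φ∈Γ)
  deduction (thm d)           = ⊃-const (thm d)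
  deduction (mp d e)          =
    mp (mp (⊩-axiom (distrib _ _ _)) (deduction d)) (deduction e)

  ∨-case : ∀ {Γ α β φ} → Γ ⊩ α ⊃ φ → Γ ⊩ β ⊃ φ → Γ ⊩ α ∨ β → Γ ⊩ φ
  ∨-case d e = mp (mp (mp (⊩-axiom (∨-elim _ _ _)) d) e)

  -- Implication abbreviates a disjunction, so `α ⊃ α` is literally `∼ α ∨ α`, the excluded middle
  -- for `α`.
  by-cases : ∀ {Γ φ} α → α ∷ Γ ⊩ φ → ∼ α ∷ Γ ⊩ φ → Γ ⊩ φ
  by-cases α d e = ∨-case (deduction e) (deduction d) (⊃-refl α)

  ∼⇒⊃ : ∀ {Γ α φ} → Γ ⊩ ∼ α → Γ ⊩ α ⊃ φ
  ∼⇒⊃ = mp (⊩-axiom (∨-introˡ _ _))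

  ∧-intro : ∀ {Γ α β} → Γ ⊩ α → Γ ⊩ β → Γ ⊩ α ∧ β
  -- `α ∧ β` is the negation of this disjunction, so the second case is a hypothesis; in the first,
  -- each disjunct clashes with `d` or `e`.
  ∧-intro {α = α} {β} d e = by-cases (∼ α ∨ ∼ β)
    (∨-case (deduction (mp (∼⇒⊃ (hyp (here refl))) (⊩-weaken (⊩-weaken d))))
            (deduction (mp (∼⇒⊃ (hyp (here refl))) (⊩-weaken (⊩-weaken e))))
            (hyp (here refl)))
    (hyp (here refl))

  Decides : List Formula → Pred Formula _
  Decides Γ ψ = (Γ ⊩ ψ) ⊎ (Γ ⊩ ∼ ψ)

  -- Each formula of `L` is added if `φ` stays unprovable. Otherwise its negation is added, which is
  -- safe: if both extensions proved `φ`, `by-cases` would already prove it from `Δ`.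
  lindenbaum : ExcludedMiddle Level.zero → ∀ {φ} → ¬ ([] ⊩ φ) → ∀ L →
               ∃ λ Δ → ¬ (Δ ⊩ φ) × All (Decides Δ) L
  lindenbaum em ⊮φ [] = [] , ⊮φ , []
  lindenbaum em {φ} ⊮φ (ψ ∷ L) with lindenbaum em ⊮φ L
  ... | Δ , Δ⊮φ , dec with em {ψ ∷ Δ ⊩ φ}
  ... | no ψΔ⊮φ = ψ ∷ Δ , ψΔ⊮φ
                , inj₁ (hyp (here refl)) ∷ All.map (Sum.map ⊩-weaken ⊩-weaken) dec
  ... | yes d   = ∼ ψ ∷ Δ , Δ⊮φ ∘ by-cases ψ d
                , inj₂ (hyp (here refl)) ∷ All.map (Sum.map ⊩-weaken ⊩-weaken) dec

  subformulas : Formula → List Formula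
  subformulas (ε a b) = ε a b ∷ []
  subformulas (φ ∨ ψ) = (φ ∨ ψ) ∷ subformulas φ ++ subformulas ψ
  subformulas (∼ φ)   = ∼ φ ∷ subformulas φ

  self-decided : ∀ {Γ} φ → All (Decides Γ) (subformulas φ) → Decides Γ φ
  self-decided (ε a b) = All.head
  self-decided (φ ∨ ψ) = All.head
  self-decided (∼ φ)   = All.head

  maxSubject : Formula → ℕ
  maxSubject (ε a b) = a
  maxSubject (φ ∨ ψ) = maxSubject φ ⊔ maxSubject ψ
  maxSubject (∼ φ)   = maxSubject φ

record IsOntology (_∈ₙ_ : Rel NameVar Level.zero) : Set where
  field
    ax1 : ∀ {a b} → a ∈ₙ b → a ∈ₙ a
    ax2 : ∀ {a b c} → a ∈ₙ b → b ∈ₙ c → a ∈ₙ c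
    ax3 : ∀ {a b c} → a ∈ₙ b → b ∈ₙ c → b ∈ₙ a

module _ where
  open Contexts

  ⊩-isOntology : ∀ Δ → IsOntology (λ a b → Δ ⊩ L₁.ε a b)
  ⊩-isOntology Δ = record
    { ax1 = mp (thm (L₁.ax1 _ _))
    ; ax2 = λ d e → mp (thm (L₁.ax2 _ _ _)) (∧-intro d e)
    ; ax3 = λ d e → mp (thm (L₁.ax3 _ _ _)) (∧-intro d e)
    }

-- Forcing on star frames.

module _ (em : ExcludedMiddle ℓ) (𝓕 : Frame ℓ) (V : Valuation 𝓕) where
  open Modal

  forces-⊃ : ∀ {w} φ ψ →
             Forces 𝓕 V w (φ ⊃ ψ) ⇔ (Forces 𝓕 V w φ → Forces 𝓕 V w ψ)
  forces-⊃ φ ψ = mk⇔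
    (λ f t → [ contradiction t , (λ u → u) ]′ f)
    (λ f → [ inj₂ ∘ f , inj₁ ]′ (toSum em))

  forces-∧ : ∀ {w} φ ψ →
             Forces 𝓕 V w (φ ∧ ψ) ⇔ (Forces 𝓕 V w φ × Forces 𝓕 V w ψ)
  forces-∧ φ ψ = mk⇔
    (λ f → decidable-stable em (f ∘ inj₁) , decidable-stable em (f ∘ inj₂))
    (λ (t , u) → [ contradiction t , contradiction u ]′)

module StarModel
  (em : ExcludedMiddle ℓ)
  {p : NameVar → PropVar} (p-injective : Injective _≡_ _≡_ p)
  {n : ℕ} {𝓕 : Frame ℓ} (star : IsStarFrame n 𝓕)
  {_∈ₙ_ : Rel NameVar Level.zero} (ontology : IsOntology _∈ₙ_)
  where
  open IsStarFrame star
  open IsOntology ontology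
  open Modal using (var; _⊃_; □_)

  -- Searching for a name behind `q` makes variables outside the range of `p` false everywhere. All
  -- variables are false at the points `η`.
  V : Valuation 𝓕
  V q w = ∃ λ a → q ≡ p a ×
    ((w ≡ * × a ∈ₙ a) ⊎ (∃ λ j → w ≡ g j × toℕ j ∈ₙ a))

  V-* : ∀ {a} → V (p a) * ⇔ a ∈ₙ a
  V-* = mk⇔ f (λ r → _ , refl , inj₁ (refl , r))
    where
    f : ∀ {a} → V (p a) * → a ∈ₙ a
    f (a′ , eq , s) with refl ← p-injective eq | s
    ... | inj₁ (_ , r)        = r
    ... | inj₂ (j , *≡gj , _) = contradiction *≡gj (*≢g j)

  V-g : ∀ {a} j → V (p a) (g j) ⇔ toℕ j ∈ₙ a
  V-g j = mk⇔ f (λ r → _ , refl , inj₂ (j , refl , r))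
    where
    f : ∀ {a} → V (p a) (g j) → toℕ j ∈ₙ a
    f (a′ , eq , s) with refl ← p-injective eq | s
    ... | inj₁ (gj≡* , _)      = contradiction (sym gj≡*) (*≢g j)
    ... | inj₂ (k , gj≡gk , r) with refl ← g-injective gj≡gk = r

  successor-of-* : ∀ {w} → Frame.Acc 𝓕 * w → ∃ λ j → w ≡ g j
  successor-of-* *Rw with to (accessible _ _) *Rw
  ... | inj₁ (j , _ , w≡gj)              = j , w≡gj
  ... | inj₂ (inj₁ (j , _ , *≡gj , _))   = contradiction *≡gj (*≢g j)
  ... | inj₂ (inj₂ (k , *≡ηk , _))       = contradiction *≡ηk (*≢η k)

  -- The successors of `*` are exactly the points `g j`, the dead end `g zero` included, so the box
  -- ranges over all indices.
  forces-□⊃ : ∀ {a b} → Forces 𝓕 V * (□ (var (p a) ⊃ var (p b))) ⇔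
              (∀ (j : Fin (ℕ.suc n)) → toℕ j ∈ₙ a → toℕ j ∈ₙ b)
  forces-□⊃ {a} {b} = mk⇔
    (λ f j r → to (V-g j) (to (imp (g j))
       (f (g j) (from (accessible _ _) (inj₁ (j , refl , refl)))) (from (V-g j) r)))
    from′
    where
    imp : ∀ w → Forces 𝓕 V w (var (p a) ⊃ var (p b)) ⇔ (V (p a) w → V (p b) w)
    imp w = forces-⊃ em 𝓕 V (var (p a)) (var (p b))
    from′ : (∀ (j : Fin (ℕ.suc n)) → toℕ j ∈ₙ a → toℕ j ∈ₙ b) →
            Forces 𝓕 V * (□ (var (p a) ⊃ var (p b)))
    from′ f w *Rw with j , refl ← successor-of-* *Rw =
      from (imp (g j)) (from (V-g j) ∘ f j ∘ to (V-g j))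

  forces-Bε : ∀ {a b} → a ≤ n → Forces 𝓕 V * (B p (L₁.ε a b)) ⇔ a ∈ₙ b
  forces-Bε {a} {b} a≤n = mk⇔ to′ from′
    where
    a⊃b = □ (var (p a) ⊃ var (p b))
    b⊃a = □ (var (p b) ⊃ var (p a))
    conj₁ = forces-∧ em 𝓕 V {*} (var (p a)) (a⊃b Modal.∧ (var (p b) ⊃ b⊃a))
    conj₂ = forces-∧ em 𝓕 V {*} a⊃b (var (p b) ⊃ b⊃a)

    to′ : Forces 𝓕 V * (B p (L₁.ε a b)) → a ∈ₙ b
    -- The inclusion is applied at the index equal to `a`, available since `a ≤ n`; `pa` gives
    -- `a ∈ₙ a`, so `p a` holds there.
    to′ f with pa , rest ← to conj₁ f =
      subst (_∈ₙ b) index≡a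
        (to forces-□⊃ (proj₁ (to conj₂ rest)) (fromℕ< (s≤s a≤n))
          (subst (_∈ₙ a) (sym index≡a) (to V-* pa)))
      where
      index≡a = toℕ-fromℕ< (s≤s a≤n)

    from′ : a ∈ₙ b → Forces 𝓕 V * (B p (L₁.ε a b))
    from′ r = from conj₁
      ( from V-* (ax1 r)
      , from conj₂
          ( from forces-□⊃ (λ _ s → ax2 s r)
          , from (forces-⊃ em 𝓕 V (var (p b)) b⊃a)
              -- From `a ∈ₙ b` and `b ∈ₙ b`, `ax3` gives `b ∈ₙ a`; transitivity then yields the
              -- reverse inclusion.
              (λ pb → from forces-□⊃ (λ _ s → ax2 s (ax3 r (to V-* pb))))))

-- The truth lemma.

module CanonicalModel
  (em : ExcludedMiddle ℓ)
  {p : NameVar → PropVar} (p-injective : Injective _≡_ _≡_ p)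
  {n : ℕ} {𝓕 : Frame ℓ} (star : IsStarFrame n 𝓕)
  {Δ : List L₁.Formula} {θ : L₁.Formula} (Δ⊮θ : ¬ (Δ Contexts.⊩ θ))
  where
  open L₁ using (ε; _∨_; ∼_)
  open Contexts
  open StarModel em p-injective star (⊩-isOntology Δ)

  True : Pred L₁.Formula ℓ
  True φ = Forces 𝓕 V (IsStarFrame.* star) (B p φ)

  consistent : ∀ {φ} → Δ ⊩ ∼ φ → ¬ (Δ ⊩ φ)
  consistent d e = Δ⊮θ (mp (∼⇒⊃ d) e)

  -- Induction on the formula. Deciding the subformulas does the work of a maximal consistent set in
  -- the cases of `∨` and `∼`.
  truth : ∀ φ → maxSubject φ ≤ n → All (Decides Δ) (subformulas φ) →
          True φ ⇔ (Δ ⊩ φ)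
  truth (ε a b) a≤n _ = forces-Bε a≤n
  truth (φ ∨ ψ) φψ≤n (_ ∷ dec) = mk⇔
    [ mp (⊩-axiom (L₁.∨-introˡ _ _)) ∘ to ihφ
    , mp (⊩-axiom (L₁.∨-introʳ _ _)) ∘ to ihψ ]′
    (λ d → disjunct d (self-decided φ decφ) (self-decided ψ decψ))
    where
    decφ = ++⁻ˡ (subformulas φ) dec
    decψ = ++⁻ʳ (subformulas φ) dec
    ihφ  = truth φ (m⊔n≤o⇒m≤o _ _ φψ≤n) decφ
    ihψ  = truth ψ (m⊔n≤o⇒n≤o (maxSubject φ) _ φψ≤n) decψ

    disjunct : Δ ⊩ φ ∨ ψ → Decides Δ φ → Decides Δ ψ → True φ ⊎ True ψ
    disjunct d (inj₁ e)  _         = inj₁ (from ihφ e)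
    disjunct d (inj₂ _)  (inj₁ e)  = inj₂ (from ihψ e)
    -- With both disjuncts refuted, `Δ` proves everything, `θ` included.
    disjunct d (inj₂ ∼φ) (inj₂ ∼ψ) = contradiction (∨-case (∼⇒⊃ ∼φ) (∼⇒⊃ ∼ψ) d) Δ⊮θ
  truth (∼ φ) φ≤n (_ ∷ dec) = mk⇔
    (λ ¬φ → [ (λ d → contradiction (from ih d) ¬φ) , (λ d → d) ]′ (self-decided φ dec))
    (λ d → consistent d ∘ to ih)
    where
    ih = truth φ φ≤n dec

-- With the variable read as constantly `P`, forcing `∼ p ∨ p` at `w` is by definition `¬ P ⊎ P`.
excluded-middle : (𝓕 : Frame ℓ) → Frame.World 𝓕 →
                  (∀ {χ} → Modal.𝐊 χ → Valid 𝓕 χ) → ExcludedMiddle ℓ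
excluded-middle 𝓕 w sound {P} = fromSum (Sum.swap (sound p⊃p (λ _ _ → P) w))
  where
  open Modal
  p⊃p : 𝐊 (var 0 ⊃ var 0)
  p⊃p = mp (mp (classical (distrib _ (var 0 ⊃ var 0) _)) (classical (weaken _ _)))
           (classical (weaken _ _))

-- Forcing lives at level `ℓ` but derivability at level zero, and both are argued about classically.
lower-em : ExcludedMiddle ℓ → ExcludedMiddle Level.zero
lower-em {ℓ} em = map′ lower lift (em {Lift ℓ _})

B-faithful-on-stars :
  ExcludedMiddle ℓ →
  {p : NameVar → PropVar} → Injective _≡_ _≡_ p →
  (H : ℕ → Frame ℓ) → (∀ n → IsStarFrame n (H n)) →
  ∀ φ → (∀ n → Valid (H n) (B p φ)) → L₁.⊢ φ
B-faithful-on-stars em p-injective H stars φ valid =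
  decidable-stable (lower-em em) refute
  where
  open Contexts
  n = maxSubject φ
  refute : ¬ ¬ (L₁.⊢ φ)
  refute ⊬φ with lindenbaum (lower-em em) (⊬φ ∘ []⊩⇒⊢) (subformulas φ)
  -- Validity is used for the valuation `V` built from `Δ`, at the world `*`.
  ... | Δ , Δ⊮φ , dec = Δ⊮φ (to (truth φ ≤-refl dec) (valid n _ _))
    where open CanonicalModel em p-injective (stars n) Δ⊮φ

theorem7p2 : ∀ {i ℓ x : Level}
    (p : NameVar → PropVar) → Injective _≡_ _≡_ p →
    (X : Pred Modal.Formula x) → Modal.IsNormal X →
    (I : Set i) → (ℕ ↣ I) →
    (F : I → Frame ℓ) →
    (∀ α → Frame.World (F α)) →
    (∀ α → Infinite (Frame.World (F α))) →
    CompleteFor X F →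
    (H : ℕ → Frame ℓ) → (∀ n → IsStarFrame n (H n)) →
    H ⊆ᶠ F →
    Faithful p X
theorem7p2 p p-injective X normal I _ F _ _ complete H stars H⊆F φ Bφ∈X =
  B-faithful-on-stars em p-injective H stars φ (λ n → sound n Bφ∈X)
  where
  sound : ∀ n {χ} → X χ → Valid (H n) χ
  sound n {χ} χ∈X with α , Hn≡Fα ← H⊆F n =
    subst (λ 𝓕 → Valid 𝓕 χ) (sym Hn≡Fα) (to (complete χ) χ∈X α)

  em = excluded-middle (H 0) (IsStarFrame.* (stars 0))
         (sound 0 ∘ Modal.IsNormal.K⊆X normal)
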